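{- Let $T$ and $B$ be lattice paths with steps $N=(0,1)$ and $E=(1,0)$ from the origin to a point $(x,y)\in\mathbb N^2$, with $T$ weakly above $B$, and let $k\ge1$. Then the pairs $(b,\ell)$ and $(t,r)$ have the same joint distribution over $\mathcal P^k(T,B)$, i.e. $$\sum_{\mathbf P\in\mathcal P^k(T,B)} u^{b(\mathbf P)}v^{\ell(\mathbf P)}=\sum_{\mathbf P\in\mathcal P^k(T,B)} u^{t(\mathbf P)}v^{r(\mathbf P)}.$$
   Context: $T$ weakly above $B$ means no point of $T$ is strictly below or strictly to the right of $B$. $\mathcal P(T,B)$ is the set of lattice paths with steps $N,E$ from the origin to $(x,y)$ lying weakly above $B$ and weakly below $T$. $\mathcal P^k(T,B)$ is the set of $k$-tuples $\mathbf P=(P_1,\dots,P_k)$ with each $P_i\in\mathcal P(T,B)$ and $P_i$ weakly above $P_{i+1}$ for $1\le i\le k-1$. For $\mathbf P\in\mathcal P^k(T,B)$: $t(\mathbf P)$ is the number of east steps of $P_1$ that are steps of $T$; $\ell(\mathbf P)$ is the number of north steps of $P_1$ that are steps of $T$; $b(\mathbf P)$ is the number of east steps of $P_k$ that are steps of $B$; $r(\mathbf P)$ is the number of north steps of $P_k$ that are steps of $B$. -}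

module Defs where

open import Data.Nat using (ℕ; zero; suc; _+_; _<_; _≟_; _<?_)
open import Data.Product using (_×_; _,_; proj₁; proj₂)
open import Data.Product.Properties using (≡-dec)
open import Data.List using (List; []; _∷_; concatMap; map; filter; length; head; last)
open import Data.List.Relation.Unary.All using (All; all?)
open import Data.List.Relation.Unary.Any using (Any; any?)
open import Data.List.Relation.Unary.Linked using (Linked; linked?)
open import Data.Vec using (Vec; toList)
import Data.Vec as V
open import Data.Maybe using (Maybe; just; nothing)
open import Relation.Nullary using (¬_; Dec; yes; no; ¬?)
open import Relation.Nullary.Decidable using (_×-dec_; _⊎-dec_; _→-dec_)
open import Relation.Binary.PropositionalEquality using (_≡_; refl)
open import Data.Sum using (_⊎_)
import Data.List.Membership.DecPropositional as DecMem

data Step : Set where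
  N E : Step

_≟S_ : (s t : Step) → Dec (s ≡ t)
N ≟S N = yes refl
N ≟S E = no λ ()
E ≟S N = no λ ()
E ≟S E = yes refl

Point : Set
Point = ℕ × ℕ

_≟P_ : (p q : Point) → Dec (p ≡ q)
_≟P_ = ≡-dec _≟_ _≟_

Path : Set
Path = List Step

move : Point → Step → Point
move (a , b) N = (a , suc b)
move (a , b) E = (suc a , b)

ptsFrom : Point → Path → List Point
ptsFrom p []      = p ∷ []
ptsFrom p (s ∷ w) = p ∷ ptsFrom (move p s) w

points : Path → List Point
points = ptsFrom (0 , 0)

endFrom : Point → Path → Point
endFrom p []      = p
endFrom p (s ∷ w) = endFrom (move p s) w

endpoint : Path → Point
endpoint = endFrom (0 , 0)

-- unit steps of a path, each recorded as (starting point, direction)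
Seg : Set
Seg = Point × Step

_≟Seg_ : (s t : Seg) → Dec (s ≡ t)
_≟Seg_ = ≡-dec _≟P_ _≟S_

segsFrom : Point → Path → List Seg
segsFrom p []      = []
segsFrom p (s ∷ w) = (p , s) ∷ segsFrom (move p s) w

segs : Path → List Seg
segs = segsFrom (0 , 0)

SameColumn : Point → Point → Set
SameColumn (a , b) (c , d) = a ≡ c

AboveIn : Point → Point → Set
AboveIn (a , b) (c , d) = a ≡ c → b < d

StrictlyBelow : Point → Path → Set
StrictlyBelow p B = Any (SameColumn p) (points B) × All (AboveIn p) (points B)

SameRow : Point → Point → Set
SameRow (a , b) (c , d) = b ≡ d

LeftIn : Point → Point → Set
LeftIn (a , b) (c , d) = b ≡ d → c < a

StrictlyRight : Point → Path → Set
StrictlyRight p B = Any (SameRow p) (points B) × All (LeftIn p) (points B)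

strictlyBelow? : ∀ p B → Dec (StrictlyBelow p B)
strictlyBelow? (a , b) B =
  any? (λ { (c , d) → a ≟ c }) (points B)
  ×-dec all? (λ { (c , d) → (a ≟ c) →-dec (b <? d) }) (points B)

strictlyRight? : ∀ p B → Dec (StrictlyRight p B)
strictlyRight? (a , b) B =
  any? (λ { (c , d) → b ≟ d }) (points B)
  ×-dec all? (λ { (c , d) → (b ≟ d) →-dec (c <? a) }) (points B)

WeaklyAbove : Path → Path → Set
WeaklyAbove T B = All (λ p → ¬ (StrictlyBelow p B ⊎ StrictlyRight p B)) (points T)

weaklyAbove? : (T B : Path) → Dec (WeaklyAbove T B)
weaklyAbove? T B = all? (λ p → ¬? (strictlyBelow? p B ⊎-dec strictlyRight? p B)) (points T)

words : ℕ → List Path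
words zero    = [] ∷ []
words (suc n) = concatMap (λ w → (N ∷ w) ∷ (E ∷ w) ∷ []) (words n)

InPTB : Path → Path → ℕ → ℕ → Path → Set
InPTB T B x y P = (endpoint P ≡ (x , y)) × (WeaklyAbove P B × WeaklyAbove T P)

inPTB? : ∀ T B x y P → Dec (InPTB T B x y P)
inPTB? T B x y P = (endpoint P ≟P (x , y)) ×-dec (weaklyAbove? P B ×-dec weaklyAbove? T P)

𝒫 : Path → Path → ℕ → ℕ → List Path
𝒫 T B x y = filter (inPTB? T B x y) (words (x + y))

tuples : ∀ {A : Set} → List A → (k : ℕ) → List (Vec A k)
tuples xs zero    = V.[] ∷ []
tuples xs (suc k) = concatMap (λ a → map (a V.∷_) (tuples xs k)) xs

-- 𝒫^k(T,B) for k = suc m : tuples with P_i weakly above P_{i+1}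
Chain : ∀ {k} → Vec Path k → Set
Chain Ps = Linked WeaklyAbove (toList Ps)

chain? : ∀ {k} (Ps : Vec Path k) → Dec (Chain Ps)
chain? Ps = linked? weaklyAbove? (toList Ps)

𝒫^ : Path → Path → ℕ → ℕ → (m : ℕ) → List (Vec Path (suc m))
𝒫^ T B x y m = filter chain? (tuples (𝒫 T B x y) (suc m))

countShared : Step → Path → Path → ℕ
countShared d P Q = length (filter (λ s → (proj₂ s ≟S d) ×-dec DecMem._∈?_ _≟Seg_ s (segs Q)) (segs P))

stat-t : Path → ∀ {m} → Vec Path (suc m) → ℕ
stat-t T Ps = countShared E (V.head Ps) T

stat-ℓ : Path → ∀ {m} → Vec Path (suc m) → ℕ
stat-ℓ T Ps = countShared N (V.head Ps) T

stat-b : Path → ∀ {m} → Vec Path (suc m) → ℕ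
stat-b B Ps = countShared E (V.last Ps) B

stat-r : Path → ∀ {m} → Vec Path (suc m) → ℕ
stat-r B Ps = countShared N (V.last Ps) B

{-# OPTIONS --safe #-}

-- Write V and U for the matrices indexed by paths whose (P , Q) entry is v ^ #(shared N steps), resp.
-- u ^ #(shared E steps), if P lies weakly above Q, and 0 otherwise; K is the common value at u = v = 1.
-- The generating function of (b , ℓ) over k-tuples is the (T , B) entry of V K^(k-1) U and that of
-- (t , r) is the one of U K^(k-1) V, so it suffices that every U commutes with every V.
-- For this, read T, P and B in parallel, one step at a time, with state (a , c): P is a levels below T and
-- c above B, where a + c = d is determined by T and B. With u = 1 + p and v = 1 + q, the matrix R_d whose
-- (i , j) entry is q ^ (j - i) for i ≤ j and p ^ (i - j) for i ≥ j intertwines the one-step transfer operators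
-- of the two weightings, and R_0 = 1.
-- Finally, a finite multiset of exponent pairs is determined by the values of its generating function.
module Submission where

open import Defs
open import Data.Nat
open import Data.Nat.Properties
open import Algebra.Properties.CommutativeSemigroup *-commutativeSemigroup using (x∙yz≈y∙xz)
open import Data.Nat.DivMod using (_/_; _%_; [m+kn]%n≡m%n; m<n⇒m%n≡m; m*n/n≡m; m<n⇒m/n≡0; +-distrib-/-∣ʳ)
open import Data.Nat.Divisibility using (n∣m*n)
open import Data.Nat.ListAction using (sum)
open import Data.Nat.ListAction.Properties using (sum-++; sum-↭)
open import Data.Nat.Tactic.RingSolver using (solve-∀)
open import Data.Bool using (if_then_else_; true; false)
open import Data.Empty using (⊥-elim)
open import Data.List using (List; []; _∷_; _++_; map; concatMap; filter; length)
open import Data.List.Extrema ≤-totalOrder using (max; v≤max⁺; xs≤max; argmax-sel)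
open import Data.List.Membership.DecPropositional _≟Seg_ using (_∈?_)
open import Data.List.Membership.Propositional using (_∈_; find; lose)
open import Data.List.Membership.Propositional.Properties using (∈-∃++; ∈-++⁺ˡ; ∈-++⁺ʳ)
open import Data.List.Properties using (map-++; map-∘; map-id-local; length-map)
open import Data.List.Relation.Binary.Permutation.Propositional using (_↭_; ↭-refl; ↭-sym; ↭-trans; ↭-reflexive; prep)
open import Data.List.Relation.Binary.Permutation.Propositional.Properties using (shift; map⁺; ↭-length)
open import Data.List.Relation.Unary.All as All using (All; []; _∷_; all?)
open import Data.List.Relation.Unary.All.Properties using (¬All⇒Any¬; ¬Any⇒All¬)
open import Data.List.Relation.Unary.Any using (here; there; any?)
open import Data.Product using (_×_; _,_; proj₁; proj₂; ∃-syntax; map₂)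
open import Data.Sum using (_⊎_; inj₁; inj₂; [_,_]′)
open import Data.Vec using (Vec)
import Data.Vec as Vec
open import Function using (id)
open import Function.Bundles using (mk⇔)
open import Relation.Nullary using (¬_; Dec; yes; no; does)
open import Relation.Nullary.Decidable using (map′; _×-dec_; _→-dec_; does-⇔; dec-true; dec-false)
open import Relation.Binary.PropositionalEquality
open ≡-Reasoning

private variable
  X Y : Set

-- Transfer operators and their intertwiner

-- The default 0 discards a middle path that would cross `T` or `B`.
down : (ℕ → ℕ) → ℕ → ℕ
down f zero    = 0
down f (suc n) = f n

-- Parallel steps in the same direction coincide exactly when the gap between the paths is 0; only
-- then do they carry the weight `w`.
at : ℕ → ℕ → ℕ
at zero    w = w
at (suc d) w = 1

at-1 : ∀ d → at d 1 ≡ 1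
at-1 zero    = refl
at-1 (suc d) = refl

-- Reads one step s of T and t of B in the product of a (u₁ , v₁)-weighted kernel from T to P and a
-- (u₂ , v₂)-weighted kernel from P to B; f is the value for the remaining steps.
step : (u₁ v₁ u₂ v₂ : ℕ) → Step → Step → (ℕ → ℕ → ℕ) → ℕ → ℕ → ℕ
step u₁ v₁ u₂ v₂ N N f a c = at a v₁ * at c v₂ * f a c + down (f (suc a)) c
step u₁ v₁ u₂ v₂ E E f a c = down (λ a′ → f a′ (suc c)) a + at a u₁ * at c u₂ * f a c
step u₁ v₁ u₂ v₂ N E f a c = at a v₁ * f a (suc c) + at c u₂ * f (suc a) c
step u₁ v₁ u₂ v₂ E N f a c = at c v₂ * down (λ a′ → f a′ c) a + at a u₁ * down (f a) c

module Intertwiner (p q : ℕ) where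

  -- H f is f multiplied by R_d, split into the entries i ≤ j (left) and i > j (right).
  left : (ℕ → ℕ → ℕ) → ℕ → ℕ → ℕ
  left f zero    c = f 0 c
  left f (suc a) c = f (suc a) c + q * left f a (suc c)

  right : (ℕ → ℕ → ℕ) → ℕ → ℕ → ℕ
  right f a zero    = 0
  right f a (suc c) = p * (f (suc a) c + right f (suc a) c)

  H : (ℕ → ℕ → ℕ) → ℕ → ℕ → ℕ
  H f a c = left f a c + right f a c

  module _ (f : ℕ → ℕ → ℕ) where
    private
      F : Step → Step → ℕ → ℕ → ℕ
      F s t = step 1 (suc q) (suc p) 1 s t f
      l = left f
      r = right f

    -- `left f a c` is the sum of `q ^ i * f (a - i) (c + i)` over `i ≤ a`, so `l (suc a) c` has one
    -- term more than `l a (suc c)`. That term comes from the surplus `q` in the weight `1 + q` of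
    -- an N step shared with `T`.
    left-NN : ∀ a c → left (F N N) a (suc c) ≡ l a (suc c) + l (suc a) c
    left-NN zero c = eq q (f 0 (suc c)) (f 1 c)
      where eq : ∀ q x y → (1 + q) * 1 * x + y ≡ x + (y + q * x)
            eq = solve-∀
    left-NN (suc a) c rewrite left-NN a (suc c) =
      eq q (f (suc a) (suc c)) (f (suc (suc a)) c) (l a (suc (suc c))) (l (suc a) (suc c))
      where eq : ∀ q x y z w → 1 * 1 * x + y + q * (z + w) ≡ x + q * z + (y + q * w)
            eq = solve-∀

    -- As nothing moves below `c = 0`, the moved terms and the surplus sum to `q * l a 0`. The
    -- factor `1 + q` is the weight that the other product gives to an N step shared with `B`.
    left-NN₀ : ∀ a → left (F N N) a 0 ≡ suc q * l a 0
    left-NN₀ zero = eq q (f 0 0)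
      where eq : ∀ q x → (1 + q) * 1 * x + 0 ≡ (1 + q) * x
            eq = solve-∀
    left-NN₀ (suc a) rewrite left-NN a 0 = eq q (f (suc a) 0) (l a 1)
      where eq : ∀ q x y → 1 * 1 * x + 0 + q * (y + (x + q * y)) ≡ (1 + q) * (x + q * y)
            eq = solve-∀

    -- `right f a c` is the sum of `p ^ j * f (a + j) (c - j)` over `1 ≤ j ≤ c`; since `a + j` is
    -- never 0, no weight `1 + q` occurs.
    right-NN : ∀ a c → right (F N N) a (suc c) ≡ r a (suc c) + r (suc a) c
    right-NN a zero = eq p (f (suc a) 0)
      where eq : ∀ p x → p * (1 * 1 * x + 0 + 0) ≡ p * (x + 0) + 0
            eq = solve-∀
    right-NN a (suc c) rewrite right-NN (suc a) c =
      eq p (f (suc a) (suc c)) (f (suc (suc a)) c) (r (suc a) (suc c)) (r (suc (suc a)) c)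
      where eq : ∀ p x y z w → p * (1 * 1 * x + y + (z + w)) ≡ p * (x + z) + p * (y + w)
            eq = solve-∀

    left-EE : ∀ a c → left (F E E) (suc a) (suc c) ≡ l a (suc (suc c)) + l (suc a) (suc c)
    left-EE zero c = eq q (f 0 (suc (suc c))) (f 1 (suc c))
      where eq : ∀ q x y → x + 1 * 1 * y + q * (0 + 1 * 1 * x) ≡ x + (y + q * x)
            eq = solve-∀
    left-EE (suc a) c rewrite left-EE a (suc c) =
      eq q (f (suc a) (suc (suc c))) (f (suc (suc a)) (suc c)) (l a (suc (suc (suc c)))) (l (suc a) (suc (suc c)))
      where eq : ∀ q x y z w → x + 1 * 1 * y + q * (z + w) ≡ x + q * z + (y + q * w)
            eq = solve-∀

    -- The surplus `p` of an E step shared with `B` leaves `p * f (suc a) 0`, which is the value of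
    -- `r a 1` needed in `H f a 1`.
    left-EE₀ : ∀ a → left (F E E) (suc a) 0 ≡ l a 1 + l (suc a) 0 + p * f (suc a) 0
    left-EE₀ zero = eq p q (f 0 1) (f 1 0)
      where eq : ∀ p q x y → x + 1 * (1 + p) * y + q * (0 + 1 * 1 * x) ≡ x + (y + q * x) + p * y
            eq = solve-∀
    left-EE₀ (suc a) rewrite left-EE a 0 = eq p q (f (suc a) 1) (f (suc (suc a)) 0) (l a 2) (l (suc a) 1)
      where eq : ∀ p q x y z w → x + 1 * (1 + p) * y + q * (z + w) ≡ x + q * z + (y + q * w) + p * y
            eq = solve-∀

    right-EE : ∀ a c → right (F E E) (suc a) (suc c) ≡ r a (suc (suc c)) + r (suc a) (suc c)
    right-EE a zero = eq p (f (suc a) 1) (f (suc (suc a)) 0)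
      where eq : ∀ p x y → p * (x + 1 * (1 + p) * y + 0) ≡ p * (x + p * (y + 0)) + p * (y + 0)
            eq = solve-∀
    right-EE a (suc c) rewrite right-EE (suc a) c =
      eq p (f (suc a) (suc (suc c))) (f (suc (suc a)) (suc c)) (r (suc a) (suc (suc c))) (r (suc (suc a)) (suc c))
      where eq : ∀ p x y z w → p * (x + 1 * 1 * y + (z + w)) ≡ p * (x + z) + p * (y + w)
            eq = solve-∀

    -- Shifting `j` by one turns the moves that lower `a`, together with the surplus at `c = 0`,
    -- into `p` times all of `H f 0 (suc c)`. Adding the left half gives the factor `1 + p`, the
    -- weight of an E step shared with `T`.
    right-EE₀ : ∀ c → right (F E E) 0 (suc c) ≡ p * H f 0 (suc c) + r 0 (suc c)
    right-EE₀ zero = eq p (f 0 1) (f 1 0)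
      where eq : ∀ p x y → p * (x + 1 * (1 + p) * y + 0) ≡ p * (x + p * (y + 0)) + p * (y + 0)
            eq = solve-∀
    right-EE₀ (suc c) rewrite right-EE 0 c =
      eq p (f 0 (suc (suc c))) (f 1 (suc c)) (r 0 (suc (suc c))) (r 1 (suc c))
      where eq : ∀ p x y z w → p * (x + 1 * 1 * y + (z + w)) ≡ p * (x + z) + p * (y + w)
            eq = solve-∀

    left-NE : ∀ a c → left (F N E) a (suc c) ≡ l a (suc (suc c)) + l (suc a) (suc c)
    left-NE zero c = eq q (f 0 (suc (suc c))) (f 1 (suc c))
      where eq : ∀ q x y → (1 + q) * x + 1 * y ≡ x + (y + q * x)
            eq = solve-∀
    left-NE (suc a) c rewrite left-NE a (suc c) =
      eq q (f (suc a) (suc (suc c))) (f (suc (suc a)) (suc c)) (l a (suc (suc (suc c)))) (l (suc a) (suc (suc c)))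
      where eq : ∀ q x y z w → 1 * x + 1 * y + q * (z + w) ≡ x + q * z + (y + q * w)
            eq = solve-∀

    left-NE₀ : ∀ a → left (F N E) a 0 ≡ l a 1 + l (suc a) 0 + p * f (suc a) 0
    left-NE₀ zero = eq p q (f 0 1) (f 1 0)
      where eq : ∀ p q x y → (1 + q) * x + (1 + p) * y ≡ x + (y + q * x) + p * y
            eq = solve-∀
    left-NE₀ (suc a) rewrite left-NE a 0 = eq p q (f (suc a) 1) (f (suc (suc a)) 0) (l a 2) (l (suc a) 1)
      where eq : ∀ p q x y z w → 1 * x + (1 + p) * y + q * (z + w) ≡ x + q * z + (y + q * w) + p * y
            eq = solve-∀

    right-NE : ∀ a c → right (F N E) a (suc c) ≡ r a (suc (suc c)) + r (suc a) (suc c)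
    right-NE a zero = eq p (f (suc a) 1) (f (suc (suc a)) 0)
      where eq : ∀ p x y → p * (1 * x + (1 + p) * y + 0) ≡ p * (x + p * (y + 0)) + p * (y + 0)
            eq = solve-∀
    right-NE a (suc c) rewrite right-NE (suc a) c =
      eq p (f (suc a) (suc (suc c))) (f (suc (suc a)) (suc c)) (r (suc a) (suc (suc c))) (r (suc (suc a)) (suc c))
      where eq : ∀ p x y z w → p * (1 * x + 1 * y + (z + w)) ≡ p * (x + z) + p * (y + w)
            eq = solve-∀

    left-EN : ∀ a c → left (F E N) (suc a) (suc c) ≡ l a (suc c) + l (suc a) c
    left-EN zero c = eq q (f 0 (suc c)) (f 1 c) (f 0 c)
      where eq : ∀ q x y z → 1 * x + 1 * y + q * (1 * 0 + 1 * x) ≡ x + (y + q * x)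
            eq = solve-∀
    left-EN (suc a) c rewrite left-EN a (suc c) =
      eq q (f (suc a) (suc c)) (f (suc (suc a)) c) (l a (suc (suc c))) (l (suc a) (suc c))
      where eq : ∀ q x y z w → 1 * x + 1 * y + q * (z + w) ≡ x + q * z + (y + q * w)
            eq = solve-∀

    left-EN₀ : ∀ a → left (F E N) (suc a) 0 ≡ suc q * l a 0
    left-EN₀ zero = eq q (f 0 0)
      where eq : ∀ q x → 1 * x + 1 * 0 + q * (1 * 0 + 1 * x) ≡ (1 + q) * x
            eq = solve-∀
    left-EN₀ (suc a) rewrite left-EN a 0 = eq q (f (suc a) 0) (l a 1)
      where eq : ∀ q x y → 1 * x + 1 * 0 + q * (y + (x + q * y)) ≡ (1 + q) * (x + q * y)
            eq = solve-∀

    right-EN : ∀ a c → right (F E N) (suc a) (suc c) ≡ r a (suc c) + r (suc a) c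
    right-EN a zero = eq p (f (suc a) 0)
      where eq : ∀ p x → p * (1 * x + 1 * 0 + 0) ≡ p * (x + 0) + 0
            eq = solve-∀
    right-EN a (suc c) rewrite right-EN (suc a) c =
      eq p (f (suc a) (suc c)) (f (suc (suc a)) c) (r (suc a) (suc c)) (r (suc (suc a)) c)
      where eq : ∀ p x y z w → p * (1 * x + 1 * y + (z + w)) ≡ p * (x + z) + p * (y + w)
            eq = solve-∀

    right-EN₀ : ∀ c → right (F E N) 0 (suc c) ≡ p * H f 0 c + r 0 c
    right-EN₀ zero = eq p (f 0 0)
      where eq : ∀ p x → p * (1 * x + 1 * 0 + 0) ≡ p * (x + 0) + 0
            eq = solve-∀
    right-EN₀ (suc c) rewrite right-EN 0 c =
      eq p (f 0 (suc c)) (f 1 c) (r 0 (suc c)) (r 1 c)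
      where eq : ∀ p x y z w → p * (1 * x + 1 * y + (z + w)) ≡ p * (x + z) + p * (y + w)
            eq = solve-∀

    -- The entries of `R_d` depend only on `j - i`, so away from `a = 0` and `c = 0` both sides are
    -- the same two values of `H f`. On the boundary the surpluses `p` and `q` account for the
    -- truncated sums.
    intertwine : ∀ s t a c → H (F s t) a c ≡ step (suc p) 1 1 (suc q) s t (H f) a c
    intertwine N N a zero rewrite left-NN₀ a | at-1 a = eq q (l a 0)
      where eq : ∀ q x → (1 + q) * x + 0 ≡ 1 * (1 + q) * (x + 0) + 0
            eq = solve-∀
    intertwine N N a (suc c) rewrite left-NN a c | right-NN a c | at-1 a =
      eq (l a (suc c)) (l (suc a) c) (r a (suc c)) (r (suc a) c)
      where eq : ∀ x y z w → (x + y) + (z + w) ≡ 1 * 1 * (x + z) + (y + w)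
            eq = solve-∀
    intertwine E E zero zero = eq p (f 0 0)
      where eq : ∀ p x → 0 + 1 * (1 + p) * x + 0 ≡ 0 + (1 + p) * 1 * (x + 0)
            eq = solve-∀
    intertwine E E zero (suc c) rewrite right-EE₀ c = eq p (f 0 (suc c)) (r 0 (suc c))
      where eq : ∀ p x y → 0 + 1 * 1 * x + (p * (x + y) + y) ≡ 0 + (1 + p) * 1 * (x + y)
            eq = solve-∀
    intertwine E E (suc a) zero rewrite left-EE₀ a = eq p (l a 1) (l (suc a) 0) (f (suc a) 0)
      where eq : ∀ p x y z → x + y + p * z + 0 ≡ x + p * (z + 0) + 1 * 1 * (y + 0)
            eq = solve-∀
    intertwine E E (suc a) (suc c) rewrite left-EE a c | right-EE a c =
      eq (l a (suc (suc c))) (l (suc a) (suc c)) (r a (suc (suc c))) (r (suc a) (suc c))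
      where eq : ∀ x y z w → (x + y) + (z + w) ≡ (x + z) + 1 * 1 * (y + w)
            eq = solve-∀
    intertwine N E a zero rewrite left-NE₀ a | at-1 a = eq p (l a 1) (l (suc a) 0) (f (suc a) 0)
      where eq : ∀ p x y z → x + y + p * z + 0 ≡ 1 * (x + p * (z + 0)) + 1 * (y + 0)
            eq = solve-∀
    intertwine N E a (suc c) rewrite left-NE a c | right-NE a c | at-1 a =
      eq (l a (suc (suc c))) (l (suc a) (suc c)) (r a (suc (suc c))) (r (suc a) (suc c))
      where eq : ∀ x y z w → (x + y) + (z + w) ≡ 1 * (x + z) + 1 * (y + w)
            eq = solve-∀
    intertwine E N zero zero = eq p q
      where eq : ∀ p q → 1 * 0 + 1 * 0 + 0 ≡ (1 + q) * 0 + (1 + p) * 0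
            eq = solve-∀
    intertwine E N zero (suc c) rewrite right-EN₀ c = eq p (f 0 c) (r 0 c)
      where eq : ∀ p x y → 1 * 0 + 1 * x + (p * (x + y) + y) ≡ 1 * 0 + (1 + p) * (x + y)
            eq = solve-∀
    intertwine E N (suc a) zero rewrite left-EN₀ a = eq q (l a 0)
      where eq : ∀ q x → (1 + q) * x + 0 ≡ (1 + q) * (x + 0) + 1 * 0
            eq = solve-∀
    intertwine E N (suc a) (suc c) rewrite left-EN a c | right-EN a c =
      eq (l a (suc c)) (l (suc a) c) (r a (suc c)) (r (suc a) c)
      where eq : ∀ x y z w → (x + y) + (z + w) ≡ 1 * (x + z) + 1 * (y + w)
            eq = solve-∀

-- The kernel of weakly comparable paths

∑ : List X → (X → ℕ) → ℕ
∑ xs f = sum (map f xs)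

∑-cong-∈ : (xs : List X) {f g : X → ℕ} → (∀ x → x ∈ xs → f x ≡ g x) → ∑ xs f ≡ ∑ xs g
∑-cong-∈ []       eq = refl
∑-cong-∈ (x ∷ xs) eq = cong₂ _+_ (eq x (here refl)) (∑-cong-∈ xs λ y y∈ → eq y (there y∈))

∑-cong : (xs : List X) {f g : X → ℕ} → (∀ x → f x ≡ g x) → ∑ xs f ≡ ∑ xs g
∑-cong xs eq = ∑-cong-∈ xs λ x _ → eq x

∑-zero : (xs : List X) → ∑ xs (λ _ → 0) ≡ 0
∑-zero []       = refl
∑-zero (x ∷ xs) = ∑-zero xs

∑-+ : (xs : List X) (f g : X → ℕ) → ∑ xs (λ x → f x + g x) ≡ ∑ xs f + ∑ xs g
∑-+ []       f g = refl
∑-+ (x ∷ xs) f g rewrite ∑-+ xs f g = eq (f x) (g x) (∑ xs f) (∑ xs g)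
  where eq : ∀ a b c d → a + b + (c + d) ≡ a + c + (b + d)
        eq = solve-∀

∑-*ˡ : (xs : List X) (k : ℕ) (f : X → ℕ) → ∑ xs (λ x → k * f x) ≡ k * ∑ xs f
∑-*ˡ []       k f = sym (*-zeroʳ k)
∑-*ˡ (x ∷ xs) k f rewrite ∑-*ˡ xs k f = sym (*-distribˡ-+ k (f x) _)

∑-*ʳ : (xs : List X) (k : ℕ) (f : X → ℕ) → ∑ xs (λ x → f x * k) ≡ ∑ xs f * k
∑-*ʳ []       k f = refl
∑-*ʳ (x ∷ xs) k f rewrite ∑-*ʳ xs k f = sym (*-distribʳ-+ k (f x) _)

∑-swap : (xs : List X) (ys : List Y) (f : X → Y → ℕ) →
         ∑ xs (λ x → ∑ ys (f x)) ≡ ∑ ys (λ y → ∑ xs (λ x → f x y))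
∑-swap []       ys f = sym (∑-zero ys)
∑-swap (x ∷ xs) ys f rewrite ∑-swap xs ys f = sym (∑-+ ys (f x) _)

∑-++ : (xs ys : List X) (f : X → ℕ) → ∑ (xs ++ ys) f ≡ ∑ xs f + ∑ ys f
∑-++ xs ys f = trans (cong sum (map-++ f xs ys)) (sum-++ (map f xs) (map f ys))

∑-map : (xs : List X) (g : X → Y) (f : Y → ℕ) → ∑ (map g xs) f ≡ ∑ xs (λ x → f (g x))
∑-map xs g f = cong sum (sym (map-∘ xs))

∑-concatMap : (xs : List X) (g : X → List Y) (f : Y → ℕ) →
              ∑ (concatMap g xs) f ≡ ∑ xs (λ x → ∑ (g x) f)
∑-concatMap []       g f = refl
∑-concatMap (x ∷ xs) g f = trans (∑-++ (g x) _ f) (cong (∑ (g x) f +_) (∑-concatMap xs g f))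

⟦_⟧ : {A : Set} → Dec A → ℕ
⟦ a? ⟧ = if does a? then 1 else 0

∑-filter : {P : X → Set} (P? : ∀ x → Dec (P x)) (xs : List X) (f : X → ℕ) →
           ∑ (filter P? xs) f ≡ ∑ xs (λ x → ⟦ P? x ⟧ * f x)
∑-filter P? []       f = refl
∑-filter P? (x ∷ xs) f with does (P? x)
... | true  = cong₂ _+_ (sym (*-identityˡ (f x))) (∑-filter P? xs f)
... | false = ∑-filter P? xs f

∑-words : ∀ n (f : Path → ℕ) →
          ∑ (words (suc n)) f ≡ ∑ (words n) (λ P → f (N ∷ P)) + ∑ (words n) (λ P → f (E ∷ P))
∑-words n f = begin
  ∑ (words (suc n)) f                                ≡⟨ ∑-concatMap (words n) _ f ⟩
  ∑ (words n) (λ P → f (N ∷ P) + (f (E ∷ P) + 0))    ≡⟨ ∑-+ (words n) _ _ ⟩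
  _                                                  ≡⟨ cong (∑ (words n) _ +_) (∑-cong (words n) λ P → +-identityʳ _) ⟩
  _                                                  ∎

∈-words⇒length : ∀ n {P} → P ∈ words n → length P ≡ n
∈-words⇒length zero    (here refl) = refl
∈-words⇒length (suc n) P∈          = go (words n) (λ _ → ∈-words⇒length n) P∈
  where
  go : ∀ ws {P} → (∀ w → w ∈ ws → length w ≡ n) →
       P ∈ concatMap (λ w → (N ∷ w) ∷ (E ∷ w) ∷ []) ws → length P ≡ suc n
  go (w ∷ ws) len (here refl)         = cong suc (len w (here refl))
  go (w ∷ ws) len (there (here refl)) = cong suc (len w (here refl))
  go (w ∷ ws) len (there (there P∈))  = go ws (λ v v∈ → len v (there v∈)) P∈

-- Dom d T B: started with T lying d levels (along the antidiagonal) above B, T stays weakly above B and ends with it.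
data Dom : ℕ → Path → Path → Set where
  []  : Dom 0 [] []
  NN  : ∀ {d T B} → Dom d T B → Dom d (N ∷ T) (N ∷ B)
  EE  : ∀ {d T B} → Dom d T B → Dom d (E ∷ T) (E ∷ B)
  NE  : ∀ {d T B} → Dom (suc d) T B → Dom d (N ∷ T) (E ∷ B)
  EN  : ∀ {d T B} → Dom d T B → Dom (suc d) (E ∷ T) (N ∷ B)

dom? : ∀ d T B → Dec (Dom d T B)
dom? zero    []      []      = yes []
dom? (suc d) []      []      = no λ ()
dom? d       []      (_ ∷ B) = no λ ()
dom? d       (_ ∷ T) []      = no λ ()
dom? d       (N ∷ T) (N ∷ B) = map′ NN (λ { (NN x) → x }) (dom? d T B)
dom? d       (E ∷ T) (E ∷ B) = map′ EE (λ { (EE x) → x }) (dom? d T B)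
dom? d       (N ∷ T) (E ∷ B) = map′ NE (λ { (NE x) → x }) (dom? (suc d) T B)
dom? zero    (E ∷ T) (N ∷ B) = no λ ()
dom? (suc d) (E ∷ T) (N ∷ B) = map′ EN (λ { (EN x) → x }) (dom? d T B)

dom-cast : ∀ {d d′ T B} → d ≡ d′ → Dom d T B → Dom d′ T B
dom-cast refl D = D

-- Gaps along the antidiagonal add; when `P` steps against both `T` and `B`, one gap grows as the
-- other shrinks. Hence a product of kernels vanishes unless `Dom` holds for the outer pair.
dom-trans : ∀ {a c T P B} → Dom a T P → Dom c P B → Dom (a + c) T B
dom-trans             []     []         = []
dom-trans             (NN x) (NN y)     = NN (dom-trans x y)
dom-trans {a} {c}     (NN x) (NE y)     = NE (dom-cast (+-suc a c) (dom-trans x y))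
dom-trans             (EE x) (EE y)     = EE (dom-trans x y)
dom-trans {a}         (EE x) (EN {c} y) = dom-cast (sym (+-suc a c)) (EN (dom-trans x y))
dom-trans             (NE x) (EE y)     = NE (dom-trans x y)
dom-trans {a}         (NE x) (EN {c} y) = NN (dom-cast (sym (+-suc a c)) (dom-trans x y))
dom-trans             (EN x) (NN y)     = EN (dom-trans x y)
dom-trans {suc a} {c} (EN x) (NE y)     = EE (dom-cast (+-suc a c) (dom-trans x y))

-- `U`, `V` and `K` at once, with an arbitrary starting gap `d` to allow recursion. The final
-- `0 ^ d` accepts only paths that end together.
kernel : (u v d : ℕ) → Path → Path → ℕ
kernel u v d       []      []      = 0 ^ d
kernel u v d       []      (_ ∷ B) = 0
kernel u v d       (_ ∷ T) []      = 0
kernel u v d       (N ∷ T) (N ∷ B) = at d v * kernel u v d T B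
kernel u v d       (E ∷ T) (E ∷ B) = at d u * kernel u v d T B
kernel u v d       (N ∷ T) (E ∷ B) = kernel u v (suc d) T B
kernel u v d       (E ∷ T) (N ∷ B) = down (λ d′ → kernel u v d′ T B) d

kernel-zero : ∀ u v d T B → ¬ Dom d T B → kernel u v d T B ≡ 0
kernel-zero u v zero    []      []      ¬D = ⊥-elim (¬D [])
kernel-zero u v (suc d) []      []      ¬D = refl
kernel-zero u v d       []      (_ ∷ B) ¬D = refl
kernel-zero u v d       (_ ∷ T) []      ¬D = refl
kernel-zero u v d       (N ∷ T) (N ∷ B) ¬D
  rewrite kernel-zero u v d T B (λ D → ¬D (NN D)) = *-zeroʳ (at d v)
kernel-zero u v d       (E ∷ T) (E ∷ B) ¬D
  rewrite kernel-zero u v d T B (λ D → ¬D (EE D)) = *-zeroʳ (at d u)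
kernel-zero u v d       (N ∷ T) (E ∷ B) ¬D = kernel-zero u v (suc d) T B (λ D → ¬D (NE D))
kernel-zero u v zero    (E ∷ T) (N ∷ B) ¬D = refl
kernel-zero u v (suc d) (E ∷ T) (N ∷ B) ¬D = kernel-zero u v d T B (λ D → ¬D (EN D))

product : (u₁ v₁ u₂ v₂ : ℕ) → Path → Path → ℕ → ℕ → ℕ
product u₁ v₁ u₂ v₂ T B a c =
  ∑ (words (length T)) λ P → kernel u₁ v₁ a T P * kernel u₂ v₂ c P B

module _ (u₁ v₁ u₂ v₂ : ℕ) (T B : Path) where
  private
    ws = words (length T)
    K₁ = kernel u₁ v₁
    K₂ = kernel u₂ v₂
    Φ  = product u₁ v₁ u₂ v₂ T B

    scale : ∀ k l a c → ∑ ws (λ P → (k * K₁ a T P) * (l * K₂ c P B)) ≡ k * l * Φ a c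
    scale k l a c = trans (∑-cong ws λ P → eq k l (K₁ a T P) (K₂ c P B)) (∑-*ˡ ws (k * l) _)
      where eq : ∀ k l x y → (k * x) * (l * y) ≡ k * l * (x * y)
            eq = solve-∀

    scaleˡ : ∀ k a c → ∑ ws (λ P → (k * K₁ a T P) * K₂ c P B) ≡ k * Φ a c
    scaleˡ k a c = trans (∑-cong ws λ P → *-assoc k _ _) (∑-*ˡ ws k _)

    scaleʳ : ∀ l a c → ∑ ws (λ P → K₁ a T P * (l * K₂ c P B)) ≡ l * Φ a c
    scaleʳ l a c = trans (∑-cong ws λ P → eq l (K₁ a T P) (K₂ c P B)) (∑-*ˡ ws l _)
      where eq : ∀ l x y → x * (l * y) ≡ l * (x * y)
            eq = solve-∀

    downʳ : ∀ a c → ∑ ws (λ P → K₁ a T P * down (λ c′ → K₂ c′ P B) c) ≡ down (Φ a) c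
    downʳ a zero    = trans (∑-cong ws λ P → *-zeroʳ (K₁ a T P)) (∑-zero ws)
    downʳ a (suc c) = refl

    downˡ : ∀ a c → ∑ ws (λ P → down (λ a′ → K₁ a′ T P) a * K₂ c P B) ≡ down (λ a′ → Φ a′ c) a
    downˡ zero    c = ∑-zero ws
    downˡ (suc a) c = refl

    scale-downˡ : ∀ l a c → ∑ ws (λ P → down (λ a′ → K₁ a′ T P) a * (l * K₂ c P B))
                            ≡ l * down (λ a′ → Φ a′ c) a
    scale-downˡ l zero    c = trans (∑-zero ws) (sym (*-zeroʳ l))
    scale-downˡ l (suc a) c = scaleʳ l a c

    scale-downʳ : ∀ k a c → ∑ ws (λ P → (k * K₁ a T P) * down (λ c′ → K₂ c′ P B) c)
                            ≡ k * down (Φ a) c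
    scale-downʳ k a zero    = trans (trans (∑-cong ws λ P → *-zeroʳ (k * K₁ a T P)) (∑-zero ws)) (sym (*-zeroʳ k))
    scale-downʳ k a (suc c) = scaleˡ k a c

  -- The sum is split by the first step of `P`: the first summand of each clause of `step` is `P`
  -- going N, the second is `P` going E. Agreement with `T` or `B` gives a factor `at`, disagreement
  -- changes `a` or `c`.
  product-step : ∀ s t a c →
    product u₁ v₁ u₂ v₂ (s ∷ T) (t ∷ B) a c ≡ step u₁ v₁ u₂ v₂ s t Φ a c
  product-step N N a c = trans (∑-words (length T) _) (cong₂ _+_ (scale (at a v₁) (at c v₂) a c) (downʳ (suc a) c))
  product-step E E a c = trans (∑-words (length T) _) (cong₂ _+_ (downˡ a (suc c)) (scale (at a u₁) (at c u₂) a c))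
  product-step N E a c = trans (∑-words (length T) _) (cong₂ _+_ (scaleˡ (at a v₁) a (suc c)) (scaleʳ (at c u₂) (suc a) c))
  product-step E N a c = trans (∑-words (length T) _) (cong₂ _+_ (scale-downˡ (at c v₂) a c) (scale-downʳ (at a u₁) a c))

-- Commutation of the weighted kernels

module _ (p q : ℕ) where
  open Intertwiner p q

  left-cong : ∀ {f g : ℕ → ℕ → ℕ} → (∀ a c → f a c ≡ g a c) → ∀ a c → left f a c ≡ left g a c
  left-cong eq zero    c = eq 0 c
  left-cong eq (suc a) c = cong₂ _+_ (eq (suc a) c) (cong (q *_) (left-cong eq a (suc c)))

  right-cong : ∀ {f g : ℕ → ℕ → ℕ} → (∀ a c → f a c ≡ g a c) → ∀ a c → right f a c ≡ right g a c
  right-cong eq a zero    = refl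
  right-cong eq a (suc c) = cong (p *_) (cong₂ _+_ (eq (suc a) c) (right-cong eq (suc a) c))

  H-cong : ∀ {f g : ℕ → ℕ → ℕ} → (∀ a c → f a c ≡ g a c) → ∀ a c → H f a c ≡ H g a c
  H-cong eq a c = cong₂ _+_ (left-cong eq a c) (right-cong eq a c)

  Φ Ψ : Path → Path → ℕ → ℕ → ℕ
  Φ = product 1 (suc q) (suc p) 1
  Ψ = product (suc p) 1 1 (suc q)

  -- Induction on the two paths: `product-step` exposes the first steps, `intertwine` carries them
  -- across `H`, and the induction hypothesis acts under `step`. All states with `a + c = d` are
  -- treated together because `H` mixes them.
  H-Φ : ∀ {d T B} → Dom d T B → ∀ a c → a + c ≡ d → H (Φ T B) a c ≡ Ψ T B a c
  -- A congruence along one antidiagonal: every state that `step` reads has `a + c` equal to the gap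
  -- of the tails, where the induction hypothesis applies.
  H-Φ-step : ∀ {d} s t {T B} → Dom d (s ∷ T) (t ∷ B) → ∀ a c → a + c ≡ d →
             step (suc p) 1 1 (suc q) s t (H (Φ T B)) a c ≡ step (suc p) 1 1 (suc q) s t (Ψ T B) a c

  H-Φ {T = []}    {[]}    []       zero zero refl = refl
  H-Φ {T = s ∷ T} {t ∷ B} D a c eq = begin
    H (Φ (s ∷ T) (t ∷ B)) a c                     ≡⟨ H-cong (product-step 1 (suc q) (suc p) 1 T B s t) a c ⟩
    H (step 1 (suc q) (suc p) 1 s t (Φ T B)) a c  ≡⟨ intertwine (Φ T B) s t a c ⟩
    step (suc p) 1 1 (suc q) s t (H (Φ T B)) a c  ≡⟨ H-Φ-step s t D a c eq ⟩
    step (suc p) 1 1 (suc q) s t (Ψ T B) a c      ≡⟨ product-step (suc p) 1 1 (suc q) T B s t a c ⟨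
    Ψ (s ∷ T) (t ∷ B) a c                         ∎

  H-Φ-step N N (NN D) a zero    eq rewrite H-Φ D a 0 eq = refl
  H-Φ-step N N (NN D) a (suc c) eq
    rewrite H-Φ D a (suc c) eq | H-Φ D (suc a) c (trans (sym (+-suc a c)) eq) = refl
  H-Φ-step E E (EE D) zero    c eq rewrite H-Φ D 0 c eq = refl
  H-Φ-step E E (EE D) (suc a) c eq
    rewrite H-Φ D (suc a) c eq | H-Φ D a (suc c) (trans (+-suc a c) eq) = refl
  H-Φ-step N E (NE D) a c eq
    rewrite H-Φ D a (suc c) (trans (+-suc a c) (cong suc eq)) | H-Φ D (suc a) c (cong suc eq) = refl
  H-Φ-step E N (EN D) zero    (suc c) refl rewrite H-Φ D 0 c refl = refl
  H-Φ-step E N (EN D) (suc a) zero    refl rewrite H-Φ D a 0 refl = refl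
  H-Φ-step E N (EN D) (suc a) (suc c) eq
    rewrite H-Φ D a (suc c) (suc-injective eq)
          | H-Φ D (suc a) c (trans (sym (+-suc a c)) (suc-injective eq)) = refl

  kernels-commute : ∀ T B → Φ T B 0 0 ≡ Ψ T B 0 0
  kernels-commute T B with dom? 0 T B
  -- This is `R_0 = 1`: `H f 0 0` reduces to `f 0 0 + 0`.
  ... | yes D = trans (sym (+-identityʳ _)) (H-Φ D 0 0 refl)
  -- By `dom-trans` no middle path fits, so both products are 0.
  ... | no ¬D = trans (vanish 1 (suc q) (suc p) 1) (sym (vanish (suc p) 1 1 (suc q)))
    where
    vanish : ∀ u₁ v₁ u₂ v₂ → product u₁ v₁ u₂ v₂ T B 0 0 ≡ 0
    vanish u₁ v₁ u₂ v₂ = trans (∑-cong (words (length T)) term) (∑-zero (words (length T)))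
      where
      term : ∀ P → kernel u₁ v₁ 0 T P * kernel u₂ v₂ 0 P B ≡ 0
      term P with dom? 0 T P
      ... | no ¬TP rewrite kernel-zero u₁ v₁ 0 T P ¬TP = refl
      ... | yes TP rewrite kernel-zero u₂ v₂ 0 P B (λ PB → ¬D (dom-trans TP PB)) = *-zeroʳ (kernel u₁ v₁ 0 T P)

-- Geometry of the relation weakly above

level : Point → ℕ
level (a , b) = a + b

level-move : ∀ p s → level (move p s) ≡ suc (level p)
level-move (a , b) N = +-suc a b
level-move (a , b) E = refl

level-endFrom : ∀ p P → level (endFrom p P) ≡ level p + length P
level-endFrom p []      = sym (+-identityʳ _)
level-endFrom p (s ∷ P) = begin
  level (endFrom (move p s) P)  ≡⟨ level-endFrom (move p s) P ⟩
  level (move p s) + length P   ≡⟨ cong (_+ length P) (level-move p s) ⟩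
  suc (level p + length P)      ≡⟨ +-suc (level p) (length P) ⟨
  level p + suc (length P)      ∎

_⊑_ : Point → Point → Set
(a , b) ⊑ (c , d) = a ≤ c × b ≤ d

⊑-refl : ∀ {p} → p ⊑ p
⊑-refl = ≤-refl , ≤-refl

⊑-trans : ∀ {p q r} → p ⊑ q → q ⊑ r → p ⊑ r
⊑-trans (x , y) (x′ , y′) = ≤-trans x x′ , ≤-trans y y′

⊑-move : ∀ p s → p ⊑ move p s
⊑-move (a , b) N = ≤-refl , n≤1+n b
⊑-move (a , b) E = n≤1+n a , ≤-refl

start∈ : ∀ p P → p ∈ ptsFrom p P
start∈ p []      = here refl
start∈ p (s ∷ P) = here refl

end∈ : ∀ p P → endFrom p P ∈ ptsFrom p P
end∈ p []      = here refl
end∈ p (s ∷ P) = there (end∈ (move p s) P)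

start⊑ : ∀ p P {q} → q ∈ ptsFrom p P → p ⊑ q
start⊑ p []      (here refl) = ⊑-refl
start⊑ p (s ∷ P) (here refl) = ⊑-refl
start⊑ p (s ∷ P) (there q∈)  = ⊑-trans (⊑-move p s) (start⊑ (move p s) P q∈)

⊑end : ∀ p P {q} → q ∈ ptsFrom p P → q ⊑ endFrom p P
⊑end p []      (here refl) = ⊑-refl
⊑end p (s ∷ P) (here refl) = ⊑-trans (⊑-move p s) (start⊑ (move p s) P (end∈ (move p s) P))
⊑end p (s ∷ P) (there q∈)  = ⊑end (move p s) P q∈

-- A step raises the first coordinate by at most 1, so no column is skipped; coordinates never
-- decrease, so the crossing is no higher than `d`.
column-hit : ∀ p P {c d} a → (c , d) ∈ ptsFrom p P → proj₁ p ≤ a → a ≤ c →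
             ∃[ b ] b ≤ d × (a , b) ∈ ptsFrom p P
column-hit p P a q∈ p≤a a≤c with m≤n⇒m<n∨m≡n p≤a
... | inj₂ refl = proj₂ p , proj₂ (start⊑ p P q∈) , start∈ p P
column-hit p []      a (here refl) p≤a a≤c | inj₁ p<a = ⊥-elim (<⇒≱ p<a a≤c)
column-hit p (s ∷ P) a (here refl) p≤a a≤c | inj₁ p<a = ⊥-elim (<⇒≱ p<a a≤c)
column-hit p (N ∷ P) a (there q∈)  p≤a a≤c | inj₁ p<a =
  let b , b≤ , ∈P = column-hit (move p N) P a q∈ p≤a a≤c in b , b≤ , there ∈P
column-hit p (E ∷ P) a (there q∈)  p≤a a≤c | inj₁ p<a =
  let b , b≤ , ∈P = column-hit (move p E) P a q∈ p<a a≤c in b , b≤ , there ∈P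

row-hit-start : ∀ p P b → proj₂ p ≤ b → b ≤ proj₂ (endFrom p P) →
                ∃[ c ] proj₁ p ≤ c × (c , b) ∈ ptsFrom p P
row-hit-start p P b p≤b b≤y with m≤n⇒m<n∨m≡n p≤b
... | inj₂ refl = proj₁ p , ≤-refl , start∈ p P
row-hit-start p []      b p≤b b≤y | inj₁ p<b = ⊥-elim (<⇒≱ p<b b≤y)
row-hit-start p (N ∷ P) b p≤b b≤y | inj₁ p<b =
  let c , ≤c , ∈P = row-hit-start (move p N) P b p<b b≤y in c , ≤c , there ∈P
row-hit-start p (E ∷ P) b p≤b b≤y | inj₁ p<b =
  let c , ≤c , ∈P = row-hit-start (move p E) P b p≤b b≤y in c , ≤-trans (n≤1+n _) ≤c , there ∈P

-- After `q` the path skips no row up to its last one and never moves left.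
row-hit : ∀ p P {q} b → q ∈ ptsFrom p P → proj₂ q ≤ b → b ≤ proj₂ (endFrom p P) →
          ∃[ c ] proj₁ q ≤ c × (c , b) ∈ ptsFrom p P
row-hit p []      b (here refl) q≤b b≤y = row-hit-start p [] b q≤b b≤y
row-hit p (s ∷ P) b (here refl) q≤b b≤y = row-hit-start p (s ∷ P) b q≤b b≤y
row-hit p (s ∷ P) b (there q∈)  q≤b b≤y =
  let c , ≤c , ∈P = row-hit (move p s) P b q∈ q≤b b≤y in c , ≤c , there ∈P

-- For paths with common endpoints, each of the two conditions in WeaklyAbove says just this.
Covers : List Point → List Point → Set
Covers ts qs = ∀ {t} → t ∈ ts → ∃[ q ] q ∈ qs × proj₁ t ≤ proj₁ q × proj₂ q ≤ proj₂ t

module _ {T B} (ends : endpoint T ≡ endpoint B) where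

  -- The witness `q` lies weakly below and to the right of `t`. On the way to `q`, `B` meets the
  -- column of `t` no higher than `t`; from `q` on, it meets the row of `t` no further left than
  -- `t`. Each refutes one alternative.
  covers⇒weaklyAbove : Covers (points T) (points B) → WeaklyAbove T B
  covers⇒weaklyAbove cov = All.tabulate λ t∈ → go t∈ (cov t∈)
    where
    go : ∀ {t} → t ∈ points T → ∃[ q ] q ∈ points B × proj₁ t ≤ proj₁ q × proj₂ q ≤ proj₂ t →
         ¬ (StrictlyBelow t B ⊎ StrictlyRight t B)
    go {t} t∈ (q , q∈ , t≤q , q≤t) (inj₁ (_ , above)) =
      let b , b≤ , ∈B = column-hit _ B (proj₁ t) q∈ z≤n t≤q
      in <⇒≱ (All.lookup above ∈B refl) (≤-trans b≤ q≤t)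
    go {t} t∈ (q , q∈ , t≤q , q≤t) (inj₂ (_ , leftOf)) =
      let t≤y = subst (λ e → proj₂ t ≤ proj₂ e) ends (proj₂ (⊑end _ T t∈))
          c , ≤c , ∈B = row-hit _ B (proj₂ t) q∈ q≤t t≤y
      in <⇒≱ (All.lookup leftOf ∈B refl) (≤-trans t≤q ≤c)

  -- The common endpoint makes `B` meet the column of `t`. Its points there cannot all be higher
  -- than `t`, and one that is not is the witness.
  weaklyAbove⇒covers : WeaklyAbove T B → Covers (points T) (points B)
  weaklyAbove⇒covers wa {t} t∈ with all? (λ q → (proj₁ t ≟ proj₁ q) →-dec (proj₂ t <? proj₂ q)) (points B)
  ... | yes above = ⊥-elim (All.lookup wa t∈ (inj₁ (lose {P = SameColumn t} ∈B refl , above)))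
    where
    t≤x = subst (λ e → proj₁ t ≤ proj₁ e) ends (proj₁ (⊑end _ T t∈))
    ∈B  = proj₂ (proj₂ (column-hit _ B (proj₁ t) (end∈ _ B) z≤n t≤x))
  ... | no ¬above with find (¬All⇒Any¬ (λ q → (proj₁ t ≟ proj₁ q) →-dec (proj₂ t <? proj₂ q)) _ ¬above)
  ...   | q , q∈ , ¬imp with proj₁ t ≟ proj₁ q
  ...     | yes eq = q , q∈ , ≤-reflexive eq , ≮⇒≥ λ t<q → ¬imp λ _ → t<q
  ...     | no ¬eq = ⊥-elim (¬imp λ eq → ⊥-elim (¬eq eq))

-- The point `q` lies `d` units right of and `d` units below `p`, on the same antidiagonal: the gap
-- that `Dom d` records.
Offset : ℕ → Point → Point → Set
Offset d (a , b) (a′ , b′) = a + d ≡ a′ × b′ + d ≡ b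

offset-level : ∀ {d} p q → Offset d p q → level p ≡ level q
offset-level {d} (a , b) (a′ , b′) (refl , refl) = trans (cong (a +_) (+-comm b′ d)) (sym (+-assoc a d b′))

offset-step : ∀ {d} p q s → Offset d p q → Offset d (move p s) (move q s)
offset-step p q N (x , y) = x , cong suc y
offset-step p q E (x , y) = cong suc x , y

offset-NE : ∀ {d} p q → Offset d p q → Offset (suc d) (move p N) (move q E)
offset-NE p q (x , y) = trans (+-suc _ _) (cong suc x) , trans (+-suc _ _) (cong suc y)

offset-EN : ∀ {d} p q → Offset (suc d) p q → Offset d (move p E) (move q N)
offset-EN p q (x , y) = trans (sym (+-suc _ _)) x , trans (sym (+-suc _ _)) y

covers-∷ : ∀ {t q ts qs} → proj₁ t ≤ proj₁ q → proj₂ q ≤ proj₂ t →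
           Covers ts qs → Covers (t ∷ ts) (q ∷ qs)
covers-∷ t≤q q≤t cov (here refl) = _ , here refl , t≤q , q≤t
covers-∷ t≤q q≤t cov (there t∈)  = map₂ (λ (q∈ , le) → there q∈ , le) (cov t∈)

dom⇒covers : ∀ {d T B} p q → Offset d p q → Dom d T B → Covers (ptsFrom p T) (ptsFrom q B)
dom⇒covers {d} p q off@(refl , refl) D = go D
  where
  le₁ : proj₁ p ≤ proj₁ q
  le₁ = m≤m+n (proj₁ p) d
  le₂ : proj₂ q ≤ proj₂ p
  le₂ = m≤m+n (proj₂ q) d
  go : ∀ {T B} → Dom d T B → Covers (ptsFrom p T) (ptsFrom q B)
  go []     = covers-∷ le₁ le₂ λ ()
  go (NN D) = covers-∷ le₁ le₂ (dom⇒covers _ _ (offset-step p q N off) D)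
  go (EE D) = covers-∷ le₁ le₂ (dom⇒covers _ _ (offset-step p q E off) D)
  go (NE D) = covers-∷ le₁ le₂ (dom⇒covers _ _ (offset-NE p q off) D)
  go (EN D) = covers-∷ le₁ le₂ (dom⇒covers _ _ (offset-EN p q off) D)

-- If a later point `t` of `T` was covered by the start `q`, the next point of `B` covers it too:
-- `t` has a larger level than `q` and is not to its right, so it is strictly higher, which leaves
-- room for an N step.
covers-tail : ∀ {s s′ T B} p q → level p ≡ level q →
              Covers (ptsFrom p (s ∷ T)) (ptsFrom q (s′ ∷ B)) →
              Covers (ptsFrom (move p s) T) (ptsFrom (move q s′) B)
covers-tail {s} {s′} {T} {B} p q lev cov {t} t∈ with cov (there t∈)
... | q′ , there q′∈ , le          = q′ , q′∈ , le
... | .q , here refl , t≤q , q≤t = move q s′ , start∈ _ B , ≤-trans t≤q (proj₁ (⊑-move q s′)) , below s′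
  where
  q<t : level q < level t
  q<t = subst (_≤ level t) (trans (level-move p s) (cong suc lev))
              (let x , y = start⊑ _ T t∈ in +-mono-≤ x y)
  below : ∀ s′ → proj₂ (move q s′) ≤ proj₂ t
  below N = ≰⇒> λ t≤q′ → <⇒≱ q<t (+-mono-≤ t≤q t≤q′)
  below E = q≤t

-- Both paths are read in parallel, and `covers-tail` passes the covering on. The one forbidden
-- configuration is E over N at gap 0.
covers⇒dom : ∀ {d} T B p q → Offset d p q → length T ≡ length B → endFrom p T ≡ endFrom q B →
             Covers (ptsFrom p T) (ptsFrom q B) → Dom d T B
covers⇒dom {zero}  [] [] p q off len end cov = []
covers⇒dom {suc d} [] [] p .p (x , _) len refl cov = ⊥-elim (m≢1+m+n (proj₁ p) (trans (sym x) (+-suc (proj₁ p) d)))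
covers⇒dom (s ∷ T) (s′ ∷ B) p q off len end cov = go s s′ off (suc-injective len) end (covers-tail p q (offset-level p q off) cov)
  where
  go : ∀ {d} s s′ → Offset d p q → length T ≡ length B → endFrom (move p s) T ≡ endFrom (move q s′) B →
       Covers (ptsFrom (move p s) T) (ptsFrom (move q s′) B) → Dom d (s ∷ T) (s′ ∷ B)
  go N N off len end cov = NN (covers⇒dom T B _ _ (offset-step p q N off) len end cov)
  go E E off len end cov = EE (covers⇒dom T B _ _ (offset-step p q E off) len end cov)
  go N E off len end cov = NE (covers⇒dom T B _ _ (offset-NE p q off) len end cov)
  go {suc d} E N off len end cov = EN (covers⇒dom T B _ _ (offset-EN p q off) len end cov)
  -- Here `p` and `q` have equal height: `T` is still at that height after its E step, while all
  -- remaining points of `B` are higher.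
  go {zero}  E N (_ , y) len end cov with cov (start∈ _ T)
  ... | q′ , q′∈ , _ , q′≤p =
    ⊥-elim (<⇒≱ (proj₂ (start⊑ _ B q′∈)) (subst (proj₂ q′ ≤_) (trans (sym y) (+-identityʳ _)) q′≤p))

endpoint⇒length : ∀ T B → endpoint T ≡ endpoint B → length T ≡ length B
endpoint⇒length T B ends =
  trans (sym (level-endFrom _ T)) (trans (cong level ends) (level-endFrom _ B))

weaklyAbove⇒dom : ∀ {T B} → endpoint T ≡ endpoint B → WeaklyAbove T B → Dom 0 T B
weaklyAbove⇒dom {T} {B} ends wa =
  covers⇒dom T B _ _ (refl , refl) (endpoint⇒length T B ends) ends (weaklyAbove⇒covers ends wa)

dom⇒endFrom : ∀ {d T B} p q → Offset d p q → Dom d T B → endFrom p T ≡ endFrom q B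
dom⇒endFrom p q (x , y) [] = cong₂ _,_ (trans (sym (+-identityʳ _)) x) (trans (sym y) (+-identityʳ _))
dom⇒endFrom p q off (NN D) = dom⇒endFrom _ _ (offset-step p q N off) D
dom⇒endFrom p q off (EE D) = dom⇒endFrom _ _ (offset-step p q E off) D
dom⇒endFrom p q off (NE D) = dom⇒endFrom _ _ (offset-NE p q off) D
dom⇒endFrom p q off (EN D) = dom⇒endFrom _ _ (offset-EN p q off) D

dom⇒endpoint : ∀ {T B} → Dom 0 T B → endpoint T ≡ endpoint B
dom⇒endpoint = dom⇒endFrom _ _ (refl , refl)

dom⇒weaklyAbove : ∀ {T B} → Dom 0 T B → WeaklyAbove T B
dom⇒weaklyAbove D = covers⇒weaklyAbove (dom⇒endpoint D) (dom⇒covers _ _ (refl , refl) D)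

-- Shared steps

⟦⟧-cong : {A A′ : Set} (a? : Dec A) (a′? : Dec A′) → (A → A′) → (A′ → A) → ⟦ a? ⟧ ≡ ⟦ a′? ⟧
⟦⟧-cong a? a′? f g = cong (λ b → if b then 1 else 0) (does-⇔ (mk⇔ f g) a? a′?)

⟦⟧-yes : {A : Set} (a? : Dec A) → A → ⟦ a? ⟧ ≡ 1
⟦⟧-yes a? a = cong (λ b → if b then 1 else 0) (dec-true a? a)

⟦⟧-no : {A : Set} (a? : Dec A) → ¬ A → ⟦ a? ⟧ ≡ 0
⟦⟧-no a? ¬a = cong (λ b → if b then 1 else 0) (dec-false a? ¬a)

length-filter : {X : Set} {P : X → Set} (P? : ∀ x → Dec (P x)) (xs : List X) →
                length (filter P? xs) ≡ ∑ xs (λ x → ⟦ P? x ⟧)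
length-filter P? []       = refl
length-filter P? (x ∷ xs) with does (P? x)
... | true  = cong suc (length-filter P? xs)
... | false = length-filter P? xs

hit? : ∀ d p s q s′ → Dec (p ≡ q × s ≡ d × s′ ≡ d)
hit? d p s q s′ = (p ≟P q) ×-dec ((s ≟S d) ×-dec (s′ ≟S d))

shared : Step → Point → Path → Point → Path → ℕ
shared d p []      q Q        = 0
shared d p (s ∷ P) q []       = 0
shared d p (s ∷ P) q (s′ ∷ Q) = ⟦ hit? d p s q s′ ⟧ + shared d (move p s) P (move q s′) Q

shared-comm : ∀ d p P q Q → shared d p P q Q ≡ shared d q Q p P
shared-comm d p []      q []       = refl
shared-comm d p []      q (s′ ∷ Q) = refl
shared-comm d p (s ∷ P) q []       = refl
shared-comm d p (s ∷ P) q (s′ ∷ Q) =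
  cong₂ _+_ (⟦⟧-cong (hit? d p s q s′) (hit? d q s′ p s) flip flip) (shared-comm d (move p s) P (move q s′) Q)
  where
  flip : ∀ {p q : Point} {s s′} → p ≡ q × s ≡ d × s′ ≡ d → q ≡ p × s′ ≡ d × s ≡ d
  flip (x , y , z) = sym x , z , y

segs-level : ∀ p P {g} → g ∈ segsFrom p P → level p ≤ level (proj₁ g)
segs-level p (s ∷ P) (here refl) = ≤-refl
segs-level p (s ∷ P) (there g∈)  =
  ≤-trans (≤-trans (n≤1+n _) (≤-reflexive (sym (level-move p s)))) (segs-level (move p s) P g∈)

sharedSeg? : ∀ d gs (g : Seg) → Dec (proj₂ g ≡ d × g ∈ gs)
sharedSeg? d gs g = (proj₂ g ≟S d) ×-dec (g ∈? gs)

-- The level of its starting point fixes the index of a unit step, so paths starting at equal levels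
-- can share a segment only at equal indices.
∑-sharedSeg : ∀ d p P q Q → level p ≡ level q →
              ∑ (segsFrom p P) (λ g → ⟦ sharedSeg? d (segsFrom q Q) g ⟧) ≡ shared d p P q Q
∑-sharedSeg d p []      q Q        lev = refl
∑-sharedSeg d p (s ∷ P) q []       lev =
  trans (∑-cong (segsFrom p (s ∷ P)) λ g → ⟦⟧-no (sharedSeg? d [] g) λ ()) (∑-zero (segsFrom p (s ∷ P)))
∑-sharedSeg d p (s ∷ P) q (s′ ∷ Q) lev = cong₂ _+_
  (⟦⟧-cong (sharedSeg? d (segsFrom q (s′ ∷ Q)) (p , s)) (hit? d p s q s′) to from)
  (trans (∑-cong-∈ (segsFrom (move p s) P) λ g g∈ →
           ⟦⟧-cong (sharedSeg? d (segsFrom q (s′ ∷ Q)) g) (sharedSeg? d (segsFrom (move q s′) Q) g)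
             (λ (eq , ∈Q) → eq , later g∈ ∈Q) (λ (eq , ∈Q) → eq , there ∈Q))
         (∑-sharedSeg d (move p s) P (move q s′) Q lev′))
  where
  lev′ : level (move p s) ≡ level (move q s′)
  lev′ = trans (level-move p s) (trans (cong suc lev) (sym (level-move q s′)))

  too-low : ∀ (p q : Point) s′ → level p ≡ level q → ¬ level (move q s′) ≤ level p
  too-low p q s′ lev le = 1+n≰n (subst (_≤ level q) (level-move q s′) (subst (level (move q s′) ≤_) lev le))

  to : s ≡ d × (p , s) ∈ segsFrom q (s′ ∷ Q) → p ≡ q × s ≡ d × s′ ≡ d
  to (eq , here refl) = refl , eq , eq
  to (eq , there ∈Q)  = ⊥-elim (too-low p q s′ lev (segs-level _ Q ∈Q))

  from : p ≡ q × s ≡ d × s′ ≡ d → s ≡ d × (p , s) ∈ segsFrom q (s′ ∷ Q)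
  from (refl , refl , refl) = refl , here refl

  later : ∀ {g} → g ∈ segsFrom (move p s) P → g ∈ segsFrom q (s′ ∷ Q) → g ∈ segsFrom (move q s′) Q
  later g∈ (here refl) = ⊥-elim (too-low q p s (sym lev) (segs-level _ P g∈))
  later g∈ (there ∈Q)  = ∈Q

countShared≡shared : ∀ d P Q → countShared d P Q ≡ shared d (0 , 0) P (0 , 0) Q
countShared≡shared d P Q =
  trans (length-filter (sharedSeg? d (segs Q)) (segs P)) (∑-sharedSeg d _ P _ Q refl)

-- The statistics `t` and `ℓ` take `P_1` before `T`, while the kernel reads `T` first.
countShared-comm : ∀ d P Q → countShared d P Q ≡ countShared d Q P
countShared-comm d P Q = trans (countShared≡shared d P Q)
  (trans (shared-comm d _ P _ Q) (sym (countShared≡shared d Q P)))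

-- Starting points coincide exactly at gap 0, and `0 ^ d` is the indicator of that.
hit-offset : ∀ {d} e p s q s′ → Offset d p q →
             ⟦ hit? e p s q s′ ⟧ ≡ 0 ^ d * ⟦ (s ≟S e) ×-dec (s′ ≟S e) ⟧
hit-offset {zero} e p s q s′ (x , y) =
  trans (⟦⟧-cong (hit? e p s q s′) ((s ≟S e) ×-dec (s′ ≟S e)) proj₂ (p≡q ,_)) (sym (+-identityʳ _))
  where p≡q : p ≡ q
        p≡q = cong₂ _,_ (trans (sym (+-identityʳ _)) x) (trans (sym y) (+-identityʳ _))
hit-offset {suc d} e p s q s′ (x , y) = ⟦⟧-no (hit? e p s q s′)
  λ { (refl , _) → m≢1+m+n (proj₁ p) (trans (sym x) (+-suc (proj₁ p) d)) }

at≡^ : ∀ d w → at d w ≡ w ^ (0 ^ d * 1)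
at≡^ zero    w = sym (*-identityʳ w)
at≡^ (suc d) w = refl

kernel-dom : ∀ {d T P} u v p q → Offset d p q → Dom d T P →
             kernel u v d T P ≡ u ^ shared E p T q P * v ^ shared N p T q P
kernel-dom u v p q off [] = refl
kernel-dom {d} u v p q off (NN {T = T} {P} D)
  rewrite hit-offset E p N q N off | hit-offset N p N q N off | *-zeroʳ (0 ^ d) | at≡^ d v
        | kernel-dom u v _ _ (offset-step p q N off) D
        | ^-distribˡ-+-* v (0 ^ d * 1) (shared N (move p N) T (move q N) P) =
  x∙yz≈y∙xz (v ^ (0 ^ d * 1)) (u ^ shared E (move p N) T (move q N) P) _
kernel-dom {d} u v p q off (EE {T = T} {P} D)
  rewrite hit-offset E p E q E off | hit-offset N p E q E off | *-zeroʳ (0 ^ d) | at≡^ d u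
        | kernel-dom u v _ _ (offset-step p q E off) D
        | ^-distribˡ-+-* u (0 ^ d * 1) (shared E (move p E) T (move q E) P) =
  sym (*-assoc (u ^ (0 ^ d * 1)) _ _)
kernel-dom {d} u v p q off (NE D)
  rewrite hit-offset E p N q E off | *-zeroʳ (0 ^ d) =
  kernel-dom u v _ _ (offset-NE p q off) D
kernel-dom {suc d} u v p q off (EN D)
  rewrite hit-offset E p E q N off =
  kernel-dom u v _ _ (offset-EN p q off) D

weight : (u v : ℕ) → Path → Path → ℕ
weight u v P Q = u ^ countShared E P Q * v ^ countShared N P Q

weight-comm : ∀ u v P Q → weight u v P Q ≡ weight u v Q P
weight-comm u v P Q = cong₂ (λ e n → u ^ e * v ^ n) (countShared-comm E P Q) (countShared-comm N P Q)

kernel≡weight : ∀ u v {T P} → Dom 0 T P → kernel u v 0 T P ≡ weight u v T P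
kernel≡weight u v {T} {P} D = trans (kernel-dom u v _ _ (refl , refl) D)
  (sym (cong₂ (λ e n → u ^ e * v ^ n) (countShared≡shared E T P) (countShared≡shared N T P)))

kernel≡⟦⟧*weight : ∀ u v T P → endpoint T ≡ endpoint P →
                   kernel u v 0 T P ≡ ⟦ weaklyAbove? T P ⟧ * weight u v T P
kernel≡⟦⟧*weight u v T P ends with dom? 0 T P
... | yes D rewrite ⟦⟧-yes (weaklyAbove? T P) (dom⇒weaklyAbove D) =
        trans (kernel≡weight u v D) (sym (*-identityˡ _))
... | no ¬D rewrite ⟦⟧-no (weaklyAbove? T P) (λ wa → ¬D (weaklyAbove⇒dom ends wa)) =
        kernel-zero u v 0 T P ¬D

-- Tuples of paths

module _ (n : ℕ) where
  private 𝒲 = words n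

  -- An entry of `K ^ m` times the weighted kernel: consecutive paths are compared with weight 1,
  -- and only the last path is weighted against `B`.
  chainKernel : (u v m : ℕ) → Path → Path → ℕ
  chainKernel u v zero    P B = kernel u v 0 P B
  chainKernel u v (suc m) P B = ∑ 𝒲 λ Q → kernel 1 1 0 P Q * chainKernel u v m Q B

  commute : ∀ p q T B → length T ≡ n →
    ∑ 𝒲 (λ P → kernel 1 (suc q) 0 T P * kernel (suc p) 1 0 P B) ≡
    ∑ 𝒲 (λ P → kernel (suc p) 1 0 T P * kernel 1 (suc q) 0 P B)
  commute p q T B refl = kernels-commute p q T B

  ∑-assoc : (f : Path → ℕ) (g : Path → Path → ℕ) (h : Path → ℕ) →
            ∑ 𝒲 (λ P → f P * ∑ 𝒲 (λ Q → g P Q * h Q)) ≡ ∑ 𝒲 (λ Q → ∑ 𝒲 (λ P → f P * g P Q) * h Q)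
  ∑-assoc f g h = begin
    ∑ 𝒲 (λ P → f P * ∑ 𝒲 (λ Q → g P Q * h Q))    ≡⟨ ∑-cong 𝒲 (λ P → ∑-*ˡ 𝒲 (f P) _) ⟨
    ∑ 𝒲 (λ P → ∑ 𝒲 (λ Q → f P * (g P Q * h Q)))  ≡⟨ ∑-swap 𝒲 𝒲 _ ⟩
    ∑ 𝒲 (λ Q → ∑ 𝒲 (λ P → f P * (g P Q * h Q)))  ≡⟨ ∑-cong 𝒲 (λ Q → ∑-cong 𝒲 λ P → *-assoc (f P) (g P Q) (h Q)) ⟨
    ∑ 𝒲 (λ Q → ∑ 𝒲 (λ P → f P * g P Q * h Q))    ≡⟨ ∑-cong 𝒲 (λ Q → ∑-*ʳ 𝒲 (h Q) _) ⟩
    ∑ 𝒲 (λ Q → ∑ 𝒲 (λ P → f P * g P Q) * h Q)    ∎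

  -- Induction on `m`: `V` moves past the first `K`, the hypothesis exchanges `V` and `U` around the
  -- remaining ones, and `U` moves to the front.
  chains-commute : ∀ p q m T B → length T ≡ n →
    ∑ 𝒲 (λ P → kernel 1 (suc q) 0 T P * chainKernel (suc p) 1 m P B) ≡
    ∑ 𝒲 (λ P → kernel (suc p) 1 0 T P * chainKernel 1 (suc q) m P B)
  chains-commute p q zero    T B len = commute p q T B len
  chains-commute p q (suc m) T B len = begin
    ∑ 𝒲 (λ P → V T P * ∑ 𝒲 (λ Q → K P Q * Uₘ Q))  ≡⟨ ∑-assoc (V T) K Uₘ ⟩
    -- At `p = 0` the kernel `U` is `K`, so `commute` says that `V` and `K` commute; `q = 0` is used
    -- likewise for `U` below.
    ∑ 𝒲 (λ Q → ∑ 𝒲 (λ P → V T P * K P Q) * Uₘ Q)  ≡⟨ ∑-cong 𝒲 (λ Q → cong (_* Uₘ Q) (commute 0 q T Q len)) ⟩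
    ∑ 𝒲 (λ Q → ∑ 𝒲 (λ P → K T P * V P Q) * Uₘ Q)  ≡⟨ ∑-assoc (K T) V Uₘ ⟨
    ∑ 𝒲 (λ P → K T P * ∑ 𝒲 (λ Q → V P Q * Uₘ Q))  ≡⟨ ∑-cong-∈ 𝒲 (λ P P∈ → cong (K T P *_) (chains-commute p q m P B (∈-words⇒length n P∈))) ⟩
    ∑ 𝒲 (λ P → K T P * ∑ 𝒲 (λ Q → U P Q * Vₘ Q))  ≡⟨ ∑-assoc (K T) U Vₘ ⟩
    ∑ 𝒲 (λ Q → ∑ 𝒲 (λ P → K T P * U P Q) * Vₘ Q)  ≡⟨ ∑-cong 𝒲 (λ Q → cong (_* Vₘ Q) (commute p 0 T Q len)) ⟩
    ∑ 𝒲 (λ Q → ∑ 𝒲 (λ P → U T P * K P Q) * Vₘ Q)  ≡⟨ ∑-assoc (U T) K Vₘ ⟨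
    ∑ 𝒲 (λ P → U T P * ∑ 𝒲 (λ Q → K P Q * Vₘ Q))  ∎
    where
    K  = kernel 1 1 0
    U  = kernel (suc p) 1 0
    V  = kernel 1 (suc q) 0
    Uₘ = λ Q → chainKernel (suc p) 1 m Q B
    Vₘ = λ Q → chainKernel 1 (suc q) m Q B

  chainKernel-zero : ∀ u v m P B → ¬ Dom 0 P B → chainKernel u v m P B ≡ 0
  chainKernel-zero u v zero    P B ¬PB = kernel-zero u v 0 P B ¬PB
  chainKernel-zero u v (suc m) P B ¬PB = trans (∑-cong 𝒲 term) (∑-zero 𝒲)
    where
    term : ∀ Q → kernel 1 1 0 P Q * chainKernel u v m Q B ≡ 0
    term Q with dom? 0 P Q
    ... | no ¬PQ rewrite kernel-zero 1 1 0 P Q ¬PQ = refl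
    ... | yes PQ rewrite chainKernel-zero u v m Q B (λ QB → ¬PB (dom-trans PQ QB)) = *-zeroʳ (kernel 1 1 0 P Q)

⟦×⟧ : {A A′ : Set} (a? : Dec A) (a′? : Dec A′) → ⟦ a? ×-dec a′? ⟧ ≡ ⟦ a? ⟧ * ⟦ a′? ⟧
⟦×⟧ a? a′? with does a?
... | true  = sym (+-identityʳ _)
... | false = refl

dom-refl : ∀ P → Dom 0 P P
dom-refl []      = []
dom-refl (N ∷ P) = NN (dom-refl P)
dom-refl (E ∷ P) = EE (dom-refl P)

weight-1 : ∀ P Q → weight 1 1 P Q ≡ 1
weight-1 P Q = cong₂ _*_ (^-zeroˡ (countShared E P Q)) (^-zeroˡ (countShared N P Q))

module _ (x y : ℕ) (T B : Path) (endT : endpoint T ≡ (x , y)) (endB : endpoint B ≡ (x , y)) where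
  private
    𝒲 = words (x + y)
    𝒴 = 𝒫 T B x y

  -- This extends a sum over `𝒫` to all words. As `T` lies above `S`, a word outside `𝒫` is not
  -- below `S` or not above `B`; then the kernel or `g` vanishes.
  ∑-𝒫 : ∀ u v S (f g : Path → ℕ) → endpoint S ≡ (x , y) → Dom 0 T S →
        (∀ Q → InPTB T B x y Q → f Q ≡ ⟦ weaklyAbove? S Q ⟧ * weight u v S Q * g Q) →
        (∀ Q → ¬ Dom 0 Q B → g Q ≡ 0) →
        ∑ 𝒴 f ≡ ∑ 𝒲 (λ Q → kernel u v 0 S Q * g Q)
  ∑-𝒫 u v S f g endS TS inside outside =
    trans (∑-filter (inPTB? T B x y) 𝒲 f) (∑-cong 𝒲 λ Q → term Q (inPTB? T B x y Q))
    where
    term : ∀ Q (in𝒫? : Dec (InPTB T B x y Q)) → ⟦ in𝒫? ⟧ * f Q ≡ kernel u v 0 S Q * g Q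
    term Q (yes in𝒫) = trans (*-identityˡ (f Q)) (trans (inside Q in𝒫)
      (cong (_* g Q) (sym (kernel≡⟦⟧*weight u v S Q (trans endS (sym (proj₁ in𝒫)))))))
    term Q (no ¬in𝒫) with dom? 0 S Q | dom? 0 Q B
    ... | no ¬SQ | _ rewrite kernel-zero u v 0 S Q ¬SQ = refl
    ... | yes _  | no ¬QB rewrite outside Q ¬QB = sym (*-zeroʳ (kernel u v 0 S Q))
    ... | yes SQ | yes QB = ⊥-elim (¬in𝒫
            (trans (dom⇒endpoint QB) endB , dom⇒weaklyAbove QB , dom⇒weaklyAbove (dom-trans TS SQ)))

  chainsBelow : (u v m : ℕ) → Path → ℕ
  chainsBelow u v m P =
    ∑ (tuples 𝒴 m) λ Ps → ⟦ chain? (P Vec.∷ Ps) ⟧ * weight u v (Vec.last (P Vec.∷ Ps)) B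

  ∑-tuples : ∀ m (f : Vec Path (suc m) → ℕ) →
             ∑ (tuples 𝒴 (suc m)) f ≡ ∑ 𝒴 (λ P → ∑ (tuples 𝒴 m) (λ Ps → f (P Vec.∷ Ps)))
  ∑-tuples m f = trans (∑-concatMap 𝒴 _ f) (∑-cong 𝒴 λ P → ∑-map (tuples 𝒴 m) (P Vec.∷_) f)

  chainsBelow-suc : ∀ u v m P →
    chainsBelow u v (suc m) P ≡ ∑ 𝒴 (λ Q → ⟦ weaklyAbove? P Q ⟧ * chainsBelow u v m Q)
  chainsBelow-suc u v m P = trans (∑-tuples m _) (∑-cong 𝒴 λ Q →
    trans (∑-cong (tuples 𝒴 m) λ Ps →
             trans (cong (_* weight u v (Vec.last (Q Vec.∷ Ps)) B) (⟦×⟧ (weaklyAbove? P Q) (chain? (Q Vec.∷ Ps))))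
                   (*-assoc ⟦ weaklyAbove? P Q ⟧ _ _))
          (∑-*ˡ (tuples 𝒴 m) ⟦ weaklyAbove? P Q ⟧ _))

  chainsBelow≡chainKernel : ∀ u v m P → InPTB T B x y P →
                            chainsBelow u v m P ≡ chainKernel (x + y) u v m P B
  chainsBelow≡chainKernel u v zero P (endP , P≥B , _) = trans (+-identityʳ _)
    (trans (*-identityˡ _) (sym (kernel≡weight u v (weaklyAbove⇒dom (trans endP (sym endB)) P≥B))))
  chainsBelow≡chainKernel u v (suc m) P (endP , _ , T≥P) = trans (chainsBelow-suc u v m P)
    (∑-𝒫 1 1 P _ (λ Q → chainKernel (x + y) u v m Q B) endP (weaklyAbove⇒dom (trans endT (sym endP)) T≥P)
      (λ Q in𝒫 → cong₂ _*_ (sym (trans (cong (⟦ weaklyAbove? P Q ⟧ *_) (weight-1 P Q)) (*-identityʳ ⟦ weaklyAbove? P Q ⟧)))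
                            (chainsBelow≡chainKernel u v m Q in𝒫))
      (λ Q → chainKernel-zero (x + y) u v m Q B))

  -- Once the head is fixed, the tails sum to `chainKernel`; `∑-𝒫` with `S = T` then turns the
  -- weight of the head into a kernel.
  ∑-𝒫^ : ∀ u₁ v₁ u₂ v₂ m →
    ∑ (𝒫^ T B x y m) (λ Ps → weight u₁ v₁ (Vec.head Ps) T * weight u₂ v₂ (Vec.last Ps) B) ≡
    ∑ 𝒲 (λ P → kernel u₁ v₁ 0 T P * chainKernel (x + y) u₂ v₂ m P B)
  ∑-𝒫^ u₁ v₁ u₂ v₂ m = begin
    ∑ (𝒫^ T B x y m) F                                                   ≡⟨ ∑-filter chain? (tuples 𝒴 (suc m)) F ⟩
    ∑ (tuples 𝒴 (suc m)) (λ Ps → ⟦ chain? Ps ⟧ * F Ps)                   ≡⟨ ∑-tuples m _ ⟩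
    ∑ 𝒴 (λ P → ∑ (tuples 𝒴 m) λ Ps → ⟦ chain? (P Vec.∷ Ps) ⟧ * F (P Vec.∷ Ps)) ≡⟨ ∑-cong 𝒴 factor ⟩
    ∑ 𝒴 (λ P → weight u₁ v₁ P T * chainsBelow u₂ v₂ m P)                 ≡⟨ ∑-𝒫 u₁ v₁ T _ _ endT (dom-refl T) inside (λ Q → chainKernel-zero (x + y) u₂ v₂ m Q B) ⟩
    ∑ 𝒲 (λ P → kernel u₁ v₁ 0 T P * chainKernel (x + y) u₂ v₂ m P B)     ∎
    where
    F : Vec Path (suc m) → ℕ
    F Ps = weight u₁ v₁ (Vec.head Ps) T * weight u₂ v₂ (Vec.last Ps) B

    factor : ∀ P → ∑ (tuples 𝒴 m) (λ Ps → ⟦ chain? (P Vec.∷ Ps) ⟧ * F (P Vec.∷ Ps)) ≡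
                   weight u₁ v₁ P T * chainsBelow u₂ v₂ m P
    factor P = trans (∑-cong (tuples 𝒴 m) λ Ps → x∙yz≈y∙xz ⟦ chain? (P Vec.∷ Ps) ⟧ (weight u₁ v₁ P T) _)
                     (∑-*ˡ (tuples 𝒴 m) (weight u₁ v₁ P T) _)

    inside : ∀ Q → InPTB T B x y Q → weight u₁ v₁ Q T * chainsBelow u₂ v₂ m Q ≡
             ⟦ weaklyAbove? T Q ⟧ * weight u₁ v₁ T Q * chainKernel (x + y) u₂ v₂ m Q B
    inside Q in𝒫@(_ , _ , T≥Q) = cong₂ _*_
      (trans (weight-comm u₁ v₁ Q T) (sym (trans (cong (_* weight u₁ v₁ T Q) (⟦⟧-yes (weaklyAbove? T Q) T≥Q)) (*-identityˡ _))))
      (chainsBelow≡chainKernel u₂ v₂ m Q in𝒫)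

  -- The pair `(b , ℓ)` puts `v` at `T` and `u` at `B`, and `(t , r)` does the reverse, so
  -- `chains-commute` applies with `u = 1 + p` and `v = 1 + q`.
  joint-sums : ∀ p q m →
    ∑ (𝒫^ T B x y m) (λ Ps → suc p ^ stat-b B Ps * suc q ^ stat-ℓ T Ps) ≡
    ∑ (𝒫^ T B x y m) (λ Ps → suc p ^ stat-t T Ps * suc q ^ stat-r B Ps)
  joint-sums p q m = begin
    ∑ 𝒫s (λ Ps → suc p ^ stat-b B Ps * suc q ^ stat-ℓ T Ps)
      ≡⟨ ∑-cong 𝒫s (λ Ps → trans (*-comm (suc p ^ stat-b B Ps) _)
           (cong₂ _*_ (one-u (suc q) (Vec.head Ps) T) (one-v (suc p) (Vec.last Ps) B))) ⟩
    ∑ 𝒫s (λ Ps → weight 1 (suc q) (Vec.head Ps) T * weight (suc p) 1 (Vec.last Ps) B)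
      ≡⟨ ∑-𝒫^ 1 (suc q) (suc p) 1 m ⟩
    ∑ 𝒲 (λ P → kernel 1 (suc q) 0 T P * chainKernel (x + y) (suc p) 1 m P B)
      ≡⟨ chains-commute (x + y) p q m T B (trans (sym (level-endFrom _ T)) (cong level endT)) ⟩
    ∑ 𝒲 (λ P → kernel (suc p) 1 0 T P * chainKernel (x + y) 1 (suc q) m P B)
      ≡⟨ ∑-𝒫^ (suc p) 1 1 (suc q) m ⟨
    ∑ 𝒫s (λ Ps → weight (suc p) 1 (Vec.head Ps) T * weight 1 (suc q) (Vec.last Ps) B)
      ≡⟨ ∑-cong 𝒫s (λ Ps → cong₂ _*_ (one-v (suc p) (Vec.head Ps) T) (one-u (suc q) (Vec.last Ps) B)) ⟨
    ∑ 𝒫s (λ Ps → suc p ^ stat-t T Ps * suc q ^ stat-r B Ps) ∎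
    where
    𝒫s = 𝒫^ T B x y m
    one-u : ∀ v P Q → v ^ countShared N P Q ≡ weight 1 v P Q
    one-u v P Q = sym (trans (cong (_* v ^ countShared N P Q) (^-zeroˡ (countShared E P Q))) (*-identityˡ _))
    one-v : ∀ u P Q → u ^ countShared E P Q ≡ weight u 1 P Q
    one-v u P Q = sym (trans (cong (u ^ countShared E P Q *_) (^-zeroˡ (countShared N P Q))) (*-identityʳ _))

-- Recovering a multiset from its generating function

∑-↭ : {xs ys : List X} (f : X → ℕ) → xs ↭ ys → ∑ xs f ≡ ∑ ys f
∑-↭ f p = sum-↭ (map⁺ f p)

∈⇒↭∷ : {x : X} {xs : List X} → x ∈ xs → ∃[ xs′ ] xs ↭ x ∷ xs′
∈⇒↭∷ {x = x} x∈ with ys , zs , refl ← ∈-∃++ x∈ = ys ++ zs , shift x ys zs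

∈⇒≤∑ : {x : X} {xs : List X} (f : X → ℕ) → x ∈ xs → f x ≤ ∑ xs f
∈⇒≤∑ {x = x} f x∈ with xs′ , p ← ∈⇒↭∷ x∈ = ≤-trans (m≤m+n (f x) _) (≤-reflexive (sym (∑-↭ f p)))

maximum : ∀ x xs → ∃[ a ] a ∈ x ∷ xs × All (_≤ a) (x ∷ xs)
maximum x xs = max x xs , [ (λ eq → here eq) , there ]′ (argmax-sel id x xs)
                        , v≤max⁺ x xs (inj₁ ≤-refl) ∷ xs≤max x xs

module _ (k : ℕ) where
  private K = suc k

  -- If all exponents were below `e`, then `K` times each power would be at most `K ^ e`, and fewer
  -- than `K` such powers sum to less than `K ^ e`.
  dominated : ∀ e ys → length ys < K → K ^ e ≤ ∑ ys (K ^_) → ∃[ y ] y ∈ ys × e ≤ y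
  dominated e ys len le with any? (e ≤?_) ys
  ... | yes some = find some
  ... | no  none = ⊥-elim (<⇒≱ (*-monoˡ-< (K ^ e) {{m^n≢0 K e}} len)
                     (≤-trans (*-monoʳ-≤ K le) (small ys (¬Any⇒All¬ ys none))))
    where
    small : ∀ zs → All (λ z → ¬ e ≤ z) zs → K * ∑ zs (K ^_) ≤ length zs * K ^ e
    small []       []          = ≤-reflexive (*-zeroʳ K)
    small (z ∷ zs) (e≰z ∷ all) = ≤-trans (≤-reflexive (*-distribˡ-+ K (K ^ z) _))
      (+-mono-≤ (^-monoʳ-≤ K (≰⇒> e≰z)) (small zs all))

  -- The largest exponents agree because fewer than K smaller powers of K cannot sum to K ^ e; remove one and recurse.
  powers-↭ : ∀ n xs ys → length xs ≡ n → n < K → length ys < K →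
             ∑ xs (K ^_) ≡ ∑ ys (K ^_) → xs ↭ ys
  powers-↭ n       []       []       _   _   _   _  = ↭-refl
  powers-↭ n       []       (y ∷ ys) _   _   _   eq = ⊥-elim (<⇒≢ (≤-trans (m^n>0 K y) (m≤m+n _ _)) eq)
  powers-↭ n       (x ∷ xs) []       _   _   _   eq = ⊥-elim (<⇒≢ (≤-trans (m^n>0 K x) (m≤m+n _ _)) (sym eq))
  powers-↭ (suc n) xs₀@(x ∷ xs) ys₀@(y ∷ ys) len n<K ly eq
    with a , a∈ , xs≤a ← maximum x xs | b , b∈ , ys≤b ← maximum y ys
    with y′ , y′∈ , a≤y′ ← dominated a ys₀ ly (≤-trans (∈⇒≤∑ (K ^_) a∈) (≤-reflexive eq))
       | x′ , x′∈ , b≤x′ ← dominated b xs₀ (subst (_< K) (sym len) n<K) (≤-trans (∈⇒≤∑ (K ^_) b∈) (≤-reflexive (sym eq)))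
    with refl ← ≤-antisym (≤-trans a≤y′ (All.lookup ys≤b y′∈)) (≤-trans b≤x′ (All.lookup xs≤a x′∈))
    with xs′ , p ← ∈⇒↭∷ a∈ | ys′ , q ← ∈⇒↭∷ b∈ =
    ↭-trans p (↭-trans (prep a (powers-↭ n xs′ ys′ (suc-injective (trans (sym (↭-length p)) len)) (<-trans (n<1+n n) n<K)
      (<-trans (n<1+n _) (subst (_< K) (↭-length q) ly))
      (+-cancelˡ-≡ (K ^ a) _ _ (trans (sym (∑-↭ (K ^_) p)) (trans eq (∑-↭ (K ^_) q)))))) (↭-sym q))

-- Substituting u = K and v = K ^ L with K and L large packs both exponents into one.
monomials-↭ : (xs ys : List (ℕ × ℕ)) →
  (∀ p q → ∑ xs (λ (b , l) → suc p ^ b * suc q ^ l) ≡ ∑ ys (λ (b , l) → suc p ^ b * suc q ^ l)) →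
  xs ↭ ys
monomials-↭ xs ys eq = ↭-trans (↭-reflexive (sym (unpack∘pack xs λ z∈ → ∈-++⁺ˡ z∈)))
  (↭-trans (map⁺ unpack packed) (↭-reflexive (unpack∘pack ys λ z∈ → ∈-++⁺ʳ xs z∈)))
  where
  -- `L` exceeds every first exponent in both lists, so remainder and quotient by `L` recover the
  -- pair.
  L = suc (∑ (xs ++ ys) proj₁)
  -- `powers-↭` needs both lists shorter than the base `K`.
  k = length xs + length ys
  K = suc k

  pack : ℕ × ℕ → ℕ
  pack (b , l) = b + l * L

  unpack : ℕ → ℕ × ℕ
  unpack n = n % L , n / L

  unpack-pack : ∀ z → proj₁ z < L → unpack (pack z) ≡ z
  unpack-pack (b , l) b<L = cong₂ _,_ (trans ([m+kn]%n≡m%n b l L) (m<n⇒m%n≡m b<L))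
    (trans (+-distrib-/-∣ʳ b {d = L} (n∣m*n l)) (cong₂ _+_ (m<n⇒m/n≡0 b<L) (m*n/n≡m l L)))

  unpack∘pack : ∀ zs → (∀ {z} → z ∈ zs → z ∈ xs ++ ys) → map unpack (map pack zs) ≡ zs
  unpack∘pack zs sub = trans (sym (map-∘ zs))
    (map-id-local (All.tabulate λ {z} z∈ → unpack-pack z (s≤s (∈⇒≤∑ proj₁ (sub z∈)))))

  -- The hypothesis evaluates at `v = suc q`, so `K ^ L` is presented as a successor.
  v-pred : ∃[ q ] suc q ≡ K ^ L
  v-pred = pred (K ^ L) , suc-pred (K ^ L) {{m^n≢0 K L}}

  monomial : ∀ b l → K ^ b * suc (proj₁ v-pred) ^ l ≡ K ^ pack (b , l)
  monomial b l = begin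
    K ^ b * suc (proj₁ v-pred) ^ l  ≡⟨ cong (λ v → K ^ b * v ^ l) (proj₂ v-pred) ⟩
    K ^ b * (K ^ L) ^ l             ≡⟨ cong (K ^ b *_) (trans (^-*-assoc K L l) (cong (K ^_) (*-comm L l))) ⟩
    K ^ b * K ^ (l * L)             ≡⟨ ^-distribˡ-+-* K b (l * L) ⟨
    K ^ (b + l * L)                 ∎

  ∑-pack : ∀ zs → ∑ (map pack zs) (K ^_) ≡ ∑ zs (λ (b , l) → K ^ b * suc (proj₁ v-pred) ^ l)
  ∑-pack zs = trans (∑-map zs pack (K ^_)) (∑-cong zs λ (b , l) → sym (monomial b l))

  packed : map pack xs ↭ map pack ys
  packed = powers-↭ k (length xs) (map pack xs) (map pack ys) (length-map pack xs)
    (s≤s (m≤m+n (length xs) (length ys)))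
    (subst (_< K) (sym (length-map pack ys)) (s≤s (m≤n+m (length ys) (length xs))))
    (trans (∑-pack xs) (trans (eq k (proj₁ v-pred)) (sym (∑-pack ys))))

theorem2p4 : (x y : ℕ) (T B : Path) → endpoint T ≡ (x , y) → endpoint B ≡ (x , y) →
    WeaklyAbove T B → (m : ℕ) →
    map (λ Ps → stat-b B Ps , stat-ℓ T Ps) (𝒫^ T B x y m)
    ↭ map (λ Ps → stat-t T Ps , stat-r B Ps) (𝒫^ T B x y m)
theorem2p4 x y T B endT endB _ m = monomials-↭ _ _ λ p q →
  trans (∑-map (𝒫^ T B x y m) _ _)
    (trans (joint-sums x y T B endT endB p q m) (sym (∑-map (𝒫^ T B x y m) _ _)))
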